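{- Let $G$ be a graph without loops. Then $G$ is R-reduced if and only if $G$ is a graph core.
   Context: Graphs are finite and undirected: $G=(V_G,E_G)$ with $E_G\subseteq V_G\times V_G$ symmetric. A relation $R\subseteq X\times Y$ has full domain if every $x\in X$ is related to some $p\in Y$, and full image if every $p\in Y$ is related to by some $x\in X$. For a graph $G$, a finite set $B$ and a relation $R\subseteq V_G\times B$ with full image, $G\ast R$ is the graph with vertex set $B$ and edge set $\{(u,v)\in B\times B : \text{there is } (x,y)\in E_G \text{ with } (x,u),(y,v)\in R\}$. The equation $G\ast R=H$ means that $R\subseteq V_G\times V_H$ has full image and $G\ast R$ equals $H$ as a graph. Let $H$ be a subgraph of $G$. An R-retraction of $G$ to $H$ is a relation $R\subseteq V_G\times V_H$ with full domain such that $G\ast R=H$ and $(x,x)\in R$ for all $x\in V_H$. A graph is R-reduced if there is no R-retraction of it to a proper subgraph. A retraction of $G$ to a subgraph $H$ is a graph homomorphism $r:V_G\to V_H$ from $G$ to $H$ with $r(x)=x$ for all $x\in V_H$. A (graph) core is a graph that does not retract to a proper subgraph. -}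

module Defs where

open import Data.Fin.Base using (Fin)
open import Data.Fin.Properties using (any?)
open import Data.Fin.Subset using (Subset; _∈_; _⊆_)
open import Data.Nat.Base using (ℕ)
open import Data.Product using (Σ-syntax; ∃; ∃₂; _×_; _,_; proj₁; proj₂)
open import Level using (0ℓ)
open import Relation.Binary.Core using (Rel; REL; _⇒_; _⇔_)
open import Relation.Binary.Definitions using (Decidable; Symmetric)
open import Relation.Binary.PropositionalEquality using (_≡_)
open import Relation.Nullary using (¬_)
open import Relation.Nullary.Decidable using (_×-dec_)

-- Finite sets are subsets of some Fin n, and the subsets of A × B are the
-- decidable relations contained in A × B.  The ambient Fin n is only a
-- reservoir of names: elements outside V are not vertices, so a graph and its
-- subgraphs (induced or not) live in the same type Graph n.

record Relation {m n : ℕ} (A : Subset m) (B : Subset n) : Set₁ where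
  field
    rel     : REL (Fin m) (Fin n) 0ℓ
    rel?    : Decidable rel
    rel⊆A×B : ∀ {x p} → rel x p → x ∈ A × p ∈ B

  FullDomain : Set
  FullDomain = ∀ {x} → x ∈ A → ∃ λ p → rel x p

  FullImage : Set
  FullImage = ∀ {p} → p ∈ B → ∃ λ x → rel x p

open Relation using (rel; FullDomain; FullImage) public

record Graph (n : ℕ) : Set₁ where
  field
    V     : Subset n
    E     : Rel (Fin n) 0ℓ
    E?    : Decidable E
    E⊆V×V : ∀ {x y} → E x y → x ∈ V × y ∈ V
    E-sym : Symmetric E

  Vertex : Set
  Vertex = Σ[ x ∈ Fin n ] x ∈ V

open Graph using (V; E; Vertex) public

infix 4 _≈_ _⊑_

-- Equality of graphs as pairs of sets: not isomorphism.
_≈_ : ∀ {n} → Graph n → Graph n → Set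
G ≈ H = V G ≡ V H × E G ⇔ E H

record _⊑_ {n} (H G : Graph n) : Set where
  field
    V⊆ : V H ⊆ V G
    E⊆ : E H ⇒ E G

open _⊑_ using (V⊆) public

Loopless : ∀ {n} → Graph n → Set
Loopless G = ∀ {x} → ¬ E G x x

infixl 7 _∗_

-- Defined for every relation; full image is imposed in _∗_≗_ below.
_∗_ : ∀ {m n} (G : Graph m) {B : Subset n} → Relation (V G) B → Graph n
_∗_ G {B} R = record
  { V     = B
  ; E     = λ u v → ∃₂ λ x y → E G x y × rel R x u × rel R y v
  ; E?    = λ u v → any? λ x → any? λ y →
              Graph.E? G x y ×-dec Relation.rel? R x u ×-dec Relation.rel? R y v
  ; E⊆V×V = λ (_ , _ , _ , xRu , yRv) →
              proj₂ (Relation.rel⊆A×B R xRu) , proj₂ (Relation.rel⊆A×B R yRv)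
  ; E-sym = λ (x , y , xEy , xRu , yRv) → y , x , Graph.E-sym G xEy , yRv , xRu
  }

_∗_≗_ : ∀ {m n} (G : Graph m) {B : Subset n} → Relation (V G) B → Graph n → Set
G ∗ R ≗ H = FullImage R × (G ∗ R) ≈ H

record RRetraction {n} {G H : Graph n} (H⊑G : H ⊑ G) : Set₁ where
  field
    R          : Relation (V G) (V H)
    fullDomain : FullDomain R
    G∗R≗H      : G ∗ R ≗ H
    fixes      : ∀ {x} → x ∈ V H → rel R x x

record Hom {m n} (G : Graph m) (H : Graph n) : Set where
  field
    map       : Vertex G → Vertex H
    preserves : ∀ {x y} → E G (proj₁ x) (proj₁ y) →
                E H (proj₁ (map x)) (proj₁ (map y))

include : ∀ {n} {G H : Graph n} → H ⊑ G → Vertex H → Vertex G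
include H⊑G (x , x∈H) = x , V⊆ H⊑G x∈H

record Retraction {n} {G H : Graph n} (H⊑G : H ⊑ G) : Set where
  field
    hom   : Hom G H
    fixes : ∀ (x : Vertex H) → Hom.map hom (include H⊑G x) ≡ x

RReduced : ∀ {n} → Graph n → Set₁
RReduced {n} G =
  ¬ (Σ[ H ∈ Graph n ] Σ[ H⊑G ∈ H ⊑ G ] ¬ (H ≈ G) × RRetraction H⊑G)

Core : ∀ {n} → Graph n → Set₁
Core {n} G =
  ¬ (Σ[ H ∈ Graph n ] Σ[ H⊑G ∈ H ⊑ G ] ¬ (H ≈ G) × Retraction H⊑G)

-- The graph of a retraction onto H is an R-retraction to
-- H, and conversely any choice of R-images that sends each vertex of H to
-- itself is a retraction, since G ∗ R = H forces it to preserve edges.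

module Submission where

open import Data.Fin.Base using (Fin)
open import Data.Fin.Properties using () renaming (_≟_ to _≟ᶠ_)
open import Data.Fin.Subset using (Subset; _∈_)
open import Data.Fin.Subset.Properties using (_∈?_)
open import Data.Nat.Base using (ℕ)
open import Data.Product using (Σ-syntax; _×_; _,_; proj₁; proj₂)
open import Data.Vec.Properties.WithK using ([]=-irrelevant)
open import Function.Bundles using (_⇔_; mk⇔)
open import Relation.Binary.PropositionalEquality
open import Relation.Nullary using (Dec; yes; no; contradiction)
open import Relation.Nullary.Decidable using (map′)
open import Defs

private variable
  m n : ℕ

-- Membership `x ∈ B` has at most one proof, so vertices may be compared by their names alone.
subset-≡ : {B : Subset n} {p q : Σ[ x ∈ Fin n ] x ∈ B} → proj₁ p ≡ proj₁ q → p ≡ q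
subset-≡ {p = x , _} refl = cong (x ,_) ([]=-irrelevant _ _)

-- `f` can be applied only to members of `A`, so the relation carries the membership proof along.
graphOf : {A : Subset m} {B : Subset n} →
          (Σ[ x ∈ Fin m ] x ∈ A → Σ[ p ∈ Fin n ] p ∈ B) → Relation A B
graphOf {A = A} {B} f = record
  { rel     = λ x p → Σ[ x∈A ∈ x ∈ A ] proj₁ (f (x , x∈A)) ≡ p
  ; rel?    = rel?
  ; rel⊆A×B = λ { (x∈A , refl) → x∈A , proj₂ (f (_ , x∈A)) }
  }
  where
  rel? : ∀ x p → Dec (Σ[ x∈A ∈ x ∈ A ] proj₁ (f (x , x∈A)) ≡ p)
  rel? x p with x ∈? A
  ... | no x∉A  = no λ (x∈A , _) → x∉A x∈A
  ... | yes x∈A = map′ (x∈A ,_)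
    -- The given membership proof need not be the one found by `∈?`; uniqueness makes both values of
    -- `f` agree.
    (λ (_ , fx≡p) → trans (cong (λ v → proj₁ (f v)) (subset-≡ refl)) fx≡p)
    (proj₁ (f (x , x∈A)) ≟ᶠ p)

module _ {G H : Graph n} (H⊑G : H ⊑ G) where

  retraction⇒Rretraction : Retraction H⊑G → RRetraction H⊑G
  retraction⇒Rretraction r = record
    { R          = graphOf map
    ; fullDomain = λ x∈G → _ , x∈G , refl
    ; G∗R≗H      = (λ p∈H → _ , fixed p∈H) , refl , image⊆H , H⊆image
    ; fixes      = fixed
    }
    where
    open Retraction r
    open Hom hom

    fixed : ∀ {x} → x ∈ V H → rel (graphOf map) x x
    fixed x∈H = V⊆ H⊑G x∈H , cong proj₁ (fixes (_ , x∈H))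

    image⊆H : ∀ {u v} → E (G ∗ graphOf map) u v → E H u v
    image⊆H (_ , _ , xEy , (_ , refl) , (_ , refl)) = preserves xEy

    H⊆image : ∀ {u v} → E H u v → E (G ∗ graphOf map) u v
    H⊆image uEv with u∈H , v∈H ← Graph.E⊆V×V H uEv =
      -- An edge of `H` is its own preimage: it is also an edge of `G`, and both endpoints are
      -- fixed.
      _ , _ , _⊑_.E⊆ H⊑G uEv , fixed u∈H , fixed v∈H

  Rretraction⇒retraction : RRetraction H⊑G → Retraction H⊑G
  Rretraction⇒retraction r = record
    { hom   = record
      { map       = λ x → proj₁ (choose x)
      ; preserves = λ {x} {y} xEy →
          image⊆H (_ , _ , xEy , proj₂ (choose x) , proj₂ (choose y))
      }
    ; fixes = choose-fixes
    }
    where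
    open RRetraction r

    image⊆H : ∀ {u v} → E (G ∗ R) u v → E H u v
    image⊆H = proj₁ (proj₂ (proj₂ G∗R≗H))

    -- For a vertex of `H`, `fullDomain` could return an image other than the vertex itself, so
    -- membership in `V H` is tested first.
    choose : (x : Vertex G) → Σ[ p ∈ Vertex H ] rel R (proj₁ x) (proj₁ p)
    choose (x , x∈G) with x ∈? V H
    ... | yes x∈H = (x , x∈H) , fixes x∈H
    ... | no _ with p , xRp ← fullDomain x∈G =
      (p , proj₂ (Relation.rel⊆A×B R xRp)) , xRp

    choose-fixes : ∀ x → proj₁ (choose (include H⊑G x)) ≡ x
    choose-fixes (x , x∈H) with x ∈? V H
    -- The chosen vertex carries the membership proof found by the test, which has to be identified
    -- with the given one.
    ... | yes _  = subset-≡ refl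
    ... | no x∉H = contradiction x∈H x∉H

proposition5p8 : (n : ℕ) (G : Graph n) → Loopless G → RReduced G ⇔ Core G
proposition5p8 n G _ = mk⇔
  (λ reduced (H , H⊑G , H≉G , r) →
    reduced (H , H⊑G , H≉G , retraction⇒Rretraction H⊑G r))
  (λ core (H , H⊑G , H≉G , r) →
    core (H , H⊑G , H≉G , Rretraction⇒retraction H⊑G r))
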